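{- There is no online algorithm for vector packing (VP) in dimension $d=3$ whose asymptotic competitive ratio is smaller than $\frac{9}{4}$.
   Context: Vector packing (VP) in dimension $d$: an item is a non-zero vector in $[0,1]^d$ with rational components. A packing of a finite collection of items is a partition of it into subsets called bins such that the vector sum of the items in every bin does not exceed $1$ in any component. For an input $L$ (a finite sequence of items), $OPT(L)$ is the minimum number of bins in a packing of the items of $L$. An online algorithm $A$ receives the items of $L$ one by one and packs each item irrevocably, before the next item is presented, into a new (empty) bin or into an already non-empty bin, keeping the packing feasible; its decisions are deterministic functions of the items presented so far (the total length of the input is not known to it). $A(L)$ denotes the number of bins $A$ uses for $L$. The asymptotic competitive ratio of $A$ is $$\lim_{K\to\infty}\ \sup_{L:\,OPT(L)\ge K}\ \frac{A(L)}{OPT(L)}\in[1,\infty].$$ -}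

module Defs where

open import Data.Integer.Base using (+_)
open import Data.List.Base using (List; []; _∷_; [_]; _∷ʳ_; concat; foldr; length; map; _[_]%=_)
open import Data.List.Relation.Binary.Permutation.Propositional using (_↭_)
open import Data.List.Relation.Unary.All using (All)
open import Data.Fin.Base using (Fin)
open import Data.Nat.Base as ℕ using (ℕ; NonZero)
open import Data.Product using (∃-syntax; _×_)
open import Data.Rational.Base using (ℚ; 0ℚ; 1ℚ; _+_; _/_; _≤_; _<_)
open import Data.Vec.Base using (Vec; replicate; zipWith)
import Data.Vec.Relation.Unary.All as Vec
open import Relation.Binary.PropositionalEquality using (_≡_; _≢_)

record Item (d : ℕ) : Set where
  field
    coords   : Vec ℚ d
    unitCube : Vec.All (λ q → 0ℚ ≤ q × q ≤ 1ℚ) coords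
    nonZero  : coords ≢ replicate d 0ℚ

Input : ℕ → Set
Input d = List (Item d)

Bin : ℕ → Set
Bin d = List (Item d)

module _ {d : ℕ} where

  load : Bin d → Vec ℚ d
  load b = foldr (zipWith _+_) (replicate d 0ℚ) (map Item.coords b)

  Fits : Bin d → Set
  Fits b = Vec.All (_≤ 1ℚ) (load b)

  -- Items are partitioned as a multiset: an item occurring several times in
  -- the input occurs equally often in the bins.
  record IsPacking (L : Input d) (bs : List (Bin d)) : Set where
    field
      partition : concat bs ↭ L
      nonEmpty  : All (_≢ []) bs
      feasible  : All Fits bs

  record IsOPT (L : Input d) (n : ℕ) : Set where
    field
      attained : ∃[ bs ] (IsPacking L bs × length bs ≡ n)
      minimal  : ∀ bs → IsPacking L bs → n ℕ.≤ length bs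

  data Decision (bs : List (Bin d)) : Set where
    newBin  : Decision bs
    intoBin : Fin (length bs) → Decision bs

  place : (bs : List (Bin d)) → Item d → Decision bs → List (Bin d)
  place bs x newBin      = [ x ] ∷ bs
  place bs x (intoBin i) = bs [ i ]%= (x ∷_)

-- `packing L` is the list of bins after the items of L, in order of arrival,
-- have been packed. It is determined by `decide` through the two equations,
-- which also ensure that every bin in it is non-empty.
record OnlineAlgorithm (d : ℕ) : Set where
  field
    packing    : Input d → List (Bin d)
    decide     : (L : Input d) (x : Item d) → Decision (packing L)
    packing-[] : packing [] ≡ []
    packing-∷ʳ : ∀ L x → packing (L ∷ʳ x) ≡ place (packing L) x (decide L x)
    feasible   : ∀ L → All Fits (packing L)

  cost : Input d → ℕ
  cost L = length (packing L)

-- Extended reals are represented by their upper cuts: x corresponds to the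
-- set of rationals strictly above x, and ∞ to the empty set.
UpperReal : Set₁
UpperReal = ℚ → Set

infix 4 _<ᵘ_

_<ᵘ_ : UpperReal → ℚ → Set
x <ᵘ q = x q

-- The supremum of the set of rationals satisfying P.
sup : (ℚ → Set) → UpperReal
sup P q = ∃[ r ] (r < q × (∀ p → P p → p ≤ r))

-- In general this is the upper limit; it is the limit of every convergent
-- sequence, in particular of every non-increasing one.
lim : (ℕ → UpperReal) → UpperReal
lim s q = ∃[ r ] (r < q × ∃[ N ] (∀ K → N ℕ.≤ K → s K <ᵘ r))

-- The values A(L)/OPT(L) with OPT(L) ≥ K. The quotient is undefined for the
-- empty input, the only one with OPT(L) = 0.
data Ratio {d : ℕ} (A : OnlineAlgorithm d) (K : ℕ) : ℚ → Set where
  ratio : ∀ L n .{{_ : NonZero n}} → IsOPT L n → K ℕ.≤ n →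
          Ratio A K (+ OnlineAlgorithm.cost A L / n)

asymptoticRatio : ∀ {d} → OnlineAlgorithm d → UpperReal
asymptoticRatio A = lim (λ K → sup (Ratio A K))

{-# OPTIONS --safe #-}

-- Call an item that opens a new bin of the algorithm large and any other item small. As the
-- decision for an item is known before the next size is chosen, a binary search over sizes makes
-- every large item much larger than all small items together.
--
-- First come kM items filling 1/k of the third coordinate, with tiny first and second
-- coordinates chosen in this way. The algorithm opens b ≥ M bins, each with a large item. Then
-- come 2M items of size slightly below 1/2 in the first coordinate, with a tiny second coordinate
-- again chosen in this way: a bin takes two of them, but only one if it holds a large first
-- item. So each bin takes at most one of the second items after being opened, and if q bins are
-- opened, then 2M − q ≤ b + q. Finally come about M − q/2 items of size almost 1 in the second
-- coordinate, which fit with small items only and hence all need new bins.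
--
-- The algorithm uses about b + q + (M − q/2) ≥ 3M/2 + 3b/4 ≥ 9M/4 bins. An offline packing
-- puts k small first items into every bin, together with either two small second items and one
-- third item, or any two second items. This takes M bins, and the b large first items
-- need only b/k more.
module Submission where

open import Data.Fin.Base using (zero; suc)
open import Data.Integer.Base as ℤ using (+_)
import Data.Integer.Properties as ℤ
open import Data.List.Base using (List; []; _∷_; [_]; _∷ʳ_; _++_; concat; length; reverse; take; drop; _[_]%=_)
import Data.List.Properties as List
open import Data.List.Relation.Binary.Permutation.Propositional as ↭ using (_↭_)
import Data.List.Relation.Binary.Permutation.Propositional.Properties as ↭
open import Data.List.Relation.Unary.All as All using (All; []; _∷_)
import Data.List.Relation.Unary.All.Properties as All
open import Data.Nat.Base as ℕ using (ℕ; zero; suc; NonZero; _+_; _*_; _∸_; _≤_; _<_; z≤n; s≤s)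
import Data.Nat.DivMod as ℕ
import Data.Nat.Properties as ℕ
open import Data.Nat.Tactic.RingSolver using (solve-∀)
open import Data.Product using (Σ-syntax; ∃-syntax; _×_; _,_; proj₁; proj₂)
open import Data.Rational.Base as ℚ using (ℚ; 0ℚ; 1ℚ; _/_; toℚᵘ; ↥_; ↧_)
import Data.Rational.Properties as ℚ
open import Data.Rational.Unnormalised.Base as ℚᵘ using (mkℚᵘ; *≡*; *≤*)
import Data.Rational.Unnormalised.Properties as ℚᵘ
open import Data.Vec.Base as Vec using (Vec; []; _∷_; replicate; zipWith)
import Data.Vec.Properties as Vec
open import Data.Vec.Relation.Binary.Pointwise.Inductive as Pointwise using (Pointwise; []; _∷_)
open import Data.Vec.Relation.Unary.All as VecAll using ([]; _∷_)
open import Relation.Binary.PropositionalEquality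
  using (_≡_; _≢_; refl; sym; trans; cong; cong₂; subst; subst₂; module ≡-Reasoning)
open import Relation.Nullary using (¬_; contradiction)
open import Defs

-- Fractions with a common denominator

toℚᵘ-/ : ∀ a d → toℚᵘ (+ a / suc d) ℚᵘ.≃ mkℚᵘ (+ a) d
toℚᵘ-/ a d = ℚ.toℚᵘ-fromℚᵘ (mkℚᵘ (+ a) d)

/-homo-+ : ∀ a b D .{{_ : NonZero D}} → + a / D ℚ.+ + b / D ≡ + (a + b) / D
/-homo-+ a b (suc d) = ℚ.toℚᵘ-injective (begin-equality
  toℚᵘ (+ a / suc d ℚ.+ + b / suc d)            ≃⟨ ℚ.toℚᵘ-homo-+ (+ a / suc d) (+ b / suc d) ⟩
  toℚᵘ (+ a / suc d) ℚᵘ.+ toℚᵘ (+ b / suc d)    ≃⟨ ℚᵘ.+-cong (toℚᵘ-/ a d) (toℚᵘ-/ b d) ⟩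
  mkℚᵘ (+ a) d ℚᵘ.+ mkℚᵘ (+ b) d                ≃⟨ *≡* (trans
    (cong (ℤ._* + suc d) (sym (ℤ.*-distribʳ-+ (+ suc d) (+ a) (+ b))))
    (ℤ.*-assoc (+ (a + b)) (+ suc d) (+ suc d))) ⟩
  mkℚᵘ (+ (a + b)) d                            ≃⟨ toℚᵘ-/ (a + b) d ⟨
  toℚᵘ (+ (a + b) / suc d)                      ∎)
  where
  open ℚᵘ.≤-Reasoning

/-mono-≤ : ∀ {a b} D .{{_ : NonZero D}} → a ≤ b → + a / D ℚ.≤ + b / D
/-mono-≤ {a} {b} (suc d) a≤b = ℚ.toℚᵘ-cancel-≤
  (ℚᵘ.≤-respˡ-≃ (ℚᵘ.≃-sym (toℚᵘ-/ a d))
  (ℚᵘ.≤-respʳ-≃ (ℚᵘ.≃-sym (toℚᵘ-/ b d))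
  (*≤* (ℤ.*-monoʳ-≤-nonNeg (+ suc d) (ℤ.+≤+ a≤b)))))

/≤⇒*≤* : ∀ a D .{{_ : NonZero D}} {q} → + a / D ℚ.≤ q → + a ℤ.* ↧ q ℤ.≤ ↥ q ℤ.* + D
/≤⇒*≤* a (suc d) {q@record{}} le = ℚᵘ.drop-*≤* (ℚᵘ.≤-respˡ-≃ (toℚᵘ-/ a d) (ℚ.toℚᵘ-mono-≤ le))

/-cancel-≤ : ∀ {a b} D .{{_ : NonZero D}} → + a / D ℚ.≤ + b / D → a ≤ b
/-cancel-≤ {a} {b} (suc d) le = ℤ.drop‿+≤+ (ℤ.*-cancelʳ-≤-pos (+ a) (+ b) (+ suc d)
  (ℚᵘ.drop-*≤* (ℚᵘ.≤-respˡ-≃ (toℚᵘ-/ a d) (ℚᵘ.≤-respʳ-≃ (toℚᵘ-/ b d) (ℚ.toℚᵘ-mono-≤ le)))))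

0/≡0 : ∀ D .{{_ : NonZero D}} → + 0 / D ≡ 0ℚ
0/≡0 (suc d) = ℚ.toℚᵘ-injective (ℚᵘ.≃-trans (toℚᵘ-/ 0 d) (*≡* refl))

D/D≡1 : ∀ D .{{_ : NonZero D}} → + D / D ≡ 1ℚ
D/D≡1 (suc d) = ℚ.toℚᵘ-injective (ℚᵘ.≃-trans (toℚᵘ-/ (suc d) d) (*≡* (ℤ.*-comm (+ suc d) (+ 1))))

/≤1⇒≤ : ∀ a D .{{_ : NonZero D}} → + a / D ℚ.≤ 1ℚ → a ≤ D
/≤1⇒≤ a D le = /-cancel-≤ D (ℚ.≤-trans le (ℚ.≤-reflexive (sym (D/D≡1 D))))

≤⇒/≤1 : ∀ a D .{{_ : NonZero D}} → a ≤ D → + a / D ℚ.≤ 1ℚ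
≤⇒/≤1 a D le = ℚ.≤-trans (/-mono-≤ D le) (ℚ.≤-reflexive (D/D≡1 D))

/≡0⇒≡0 : ∀ a D .{{_ : NonZero D}} → + a / D ≡ 0ℚ → a ≡ 0
/≡0⇒≡0 a D eq = ℕ.n≤0⇒n≡0 (/-cancel-≤ D (ℚ.≤-reflexive (trans eq (sym (0/≡0 D)))))

-- Componentwise arithmetic and loads of bins

_⊞_ : ∀ {d} → Vec ℕ d → Vec ℕ d → Vec ℕ d
_⊞_ = zipWith _+_

_⊡_ : ∀ {d} → ℕ → Vec ℕ d → Vec ℕ d
n ⊡ v = Vec.map (n *_) v

infixl 6 _⊞_
infixl 7 _⊡_

0⊡ : ∀ {d} (v : Vec ℕ d) → 0 ⊡ v ≡ replicate d 0
0⊡ []      = refl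
0⊡ (_ ∷ v) = cong (0 ∷_) (0⊡ v)

suc⊡ : ∀ n {d} (v : Vec ℕ d) → suc n ⊡ v ≡ v ⊞ n ⊡ v
suc⊡ n []      = refl
suc⊡ n (a ∷ v) = cong (suc n * a ∷_) (suc⊡ n v)

suc⊡⊞ : ∀ n {d} (w v : Vec ℕ d) → suc n ⊡ w ⊞ v ≡ w ⊞ (n ⊡ w ⊞ v)
suc⊡⊞ n w v = trans (cong (_⊞ v) (suc⊡ n w)) (Vec.zipWith-assoc ℕ.+-assoc w (n ⊡ w) v)

v≤u⊞v : ∀ {d} (u v : Vec ℕ d) → Pointwise _≤_ v (u ⊞ v)
v≤u⊞v []      []      = []
v≤u⊞v (a ∷ u) (b ∷ v) = ℕ.m≤n+m b a ∷ v≤u⊞v u v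

module _ {d : ℕ} where

  infix 4 _≼_

  _≼_ : Vec ℚ d → Vec ℚ d → Set
  _≼_ = Pointwise ℚ._≤_

  ≼-trans : ∀ {u v w} → u ≼ v → v ≼ w → u ≼ w
  ≼-trans = Pointwise.trans ℚ.≤-trans

  ≼-reflexive : ∀ {u v} → u ≡ v → u ≼ v
  ≼-reflexive refl = Pointwise.refl ℚ.≤-refl

  load-↭ : ∀ {xs ys : Bin d} → xs ↭ ys → load xs ≡ load ys
  load-↭ ↭.refl = refl
  load-↭ (↭.prep x p) = cong (zipWith ℚ._+_ (Item.coords x)) (load-↭ p)
  load-↭ (↭.swap {xs} {ys} x y p) = begin
    u ⊕ (v ⊕ load xs)   ≡⟨ cong (λ w → u ⊕ (v ⊕ w)) (load-↭ p) ⟩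
    u ⊕ (v ⊕ load ys)   ≡⟨ Vec.zipWith-assoc ℚ.+-assoc u v _ ⟨
    u ⊕ v ⊕ load ys     ≡⟨ cong (_⊕ load ys) (Vec.zipWith-comm ℚ.+-comm u v) ⟩
    v ⊕ u ⊕ load ys     ≡⟨ Vec.zipWith-assoc ℚ.+-assoc v u _ ⟩
    v ⊕ (u ⊕ load ys)   ∎
    where
    open ≡-Reasoning
    infixl 6 _⊕_
    _⊕_ : Vec ℚ d → Vec ℚ d → Vec ℚ d
    _⊕_ = zipWith ℚ._+_
    u v : Vec ℚ d
    u = Item.coords x
    v = Item.coords y
  load-↭ (↭.trans p q) = trans (load-↭ p) (load-↭ q)

⊕-mono : ∀ {d} {u u′ v v′ : Vec ℚ d} → u ≼ u′ → v ≼ v′ → zipWith ℚ._+_ u v ≼ zipWith ℚ._+_ u′ v′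
⊕-mono []       []       = []
⊕-mono (p ∷ ps) (q ∷ qs) = ℚ.+-mono-≤ p q ∷ ⊕-mono ps qs

0≼ : ∀ {d} {v : Vec ℚ d} → VecAll.All (λ q → 0ℚ ℚ.≤ q × q ℚ.≤ 1ℚ) v → replicate d 0ℚ ≼ v
0≼ []       = []
0≼ (p ∷ ps) = proj₁ p ∷ 0≼ ps

load-∷-≽ : ∀ {d} (x : Item d) (b : Bin d) → load b ≼ load (x ∷ b)
load-∷-≽ x b = ≼-trans
  (≼-reflexive (sym (Vec.zipWith-identityˡ ℚ.+-identityˡ (load b))))
  (⊕-mono (0≼ (Item.unitCube x)) (≼-reflexive refl))

-- Offline packings

-- Packings in which bins may be empty.
Packable : ∀ {d} → ℕ → Input d → Set
Packable m L = ∃[ bs ] (concat bs ↭ L × All Fits bs × length bs ≤ m)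

Packable-++ : ∀ {d m n} {L L′ : Input d} → Packable m L → Packable n L′ → Packable (m + n) (L ++ L′)
Packable-++ (bs , p , f , l) (bs′ , p′ , f′ , l′) =
  bs ++ bs′ ,
  ↭.↭-trans (↭.↭-reflexive (sym (List.concat-++ bs bs′))) (↭.++⁺ p p′) ,
  All.++⁺ f f′ ,
  ℕ.≤-trans (ℕ.≤-reflexive (List.length-++ bs)) (ℕ.+-mono-≤ l l′)

Packable-resp-↭ : ∀ {d m} {L L′ : Input d} → L ↭ L′ → Packable m L → Packable m L′
Packable-resp-↭ L↭L′ (bs , p , rest) = bs , ↭.↭-trans p L↭L′ , rest

-- Needed because `IsPacking` forbids empty bins; dropping them keeps the concatenation and can only
-- shorten the list.
prune : ∀ {d} (bs : List (Bin d)) → All Fits bs →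
        ∃[ cs ] (concat cs ≡ concat bs × All (_≢ []) cs × All Fits cs × length cs ≤ length bs)
prune []             []       = [] , refl , [] , [] , z≤n
prune ([] ∷ bs)      (_ ∷ fs) with prune bs fs
... | cs , e , n , f , l = cs , e , n , f , ℕ.m≤n⇒m≤1+n l
prune ((x ∷ b) ∷ bs) (f ∷ fs) with prune bs fs
... | cs , e , n , f′ , l = (x ∷ b) ∷ cs , cong ((x ∷ b) ++_) e , (λ ()) ∷ n , f ∷ f′ , s≤s l

Packable⇒IsPacking : ∀ {d m} {L : Input d} → Packable m L → ∃[ bs ] (IsPacking L bs × length bs ≤ m)
Packable⇒IsPacking (bs , p , f , l) with prune bs f
... | cs , e , n , f′ , l′ =
  cs , record { partition = ↭.↭-trans (↭.↭-reflexive e) p ; nonEmpty = n ; feasible = f′ } , ℕ.≤-trans l′ l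

-- An optimal packing exists only up to double negation, as packings
-- of a given length are not decidable.
¬¬IsOPT : ∀ {d} {L : Input d} m bs → IsPacking L bs → length bs < m →
          ¬ ¬ (∃[ n ] (IsOPT L n × n ≤ length bs))
¬¬IsOPT (suc m) bs p (s≤s l) none =
  none (length bs , record { attained = bs , p , refl ; minimal = minimal } , ℕ.≤-refl)
  where
  minimal : ∀ cs → IsPacking _ cs → length bs ≤ length cs
  -- Descent on `m`: a packing shorter than `bs` would lead to an optimum through the smaller bound,
  -- and `none` excludes that.
  minimal cs q = ℕ.≮⇒≥ λ cs<bs → ¬¬IsOPT m cs q (ℕ.<-≤-trans cs<bs l)
    λ where (n , o , le) → none (n , o , ℕ.≤-trans le (ℕ.<⇒≤ cs<bs))

interleave : ∀ {A : Set} (a a′ b b′ c c′ : List A) →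
             (a ++ b ++ c) ++ (a′ ++ b′ ++ c′) ↭ (a ++ a′) ++ (b ++ b′) ++ (c ++ c′)
interleave {A} a a′ b b′ c c′ = begin
  (a ++ b ++ c) ++ (a′ ++ b′ ++ c′)     ↭⟨ exchange a (b ++ c) a′ (b′ ++ c′) ⟩
  (a ++ a′) ++ (b ++ c) ++ (b′ ++ c′)   ↭⟨ ↭.++⁺ˡ (a ++ a′) (exchange b c b′ c′) ⟩
  (a ++ a′) ++ (b ++ b′) ++ (c ++ c′)   ∎
  where
  open ↭.PermutationReasoning
  exchange : ∀ (xs ys zs ws : List A) → (xs ++ ys) ++ (zs ++ ws) ↭ (xs ++ zs) ++ (ys ++ ws)
  exchange xs ys zs ws = begin
    (xs ++ ys) ++ (zs ++ ws)   ≡⟨ List.++-assoc xs ys (zs ++ ws) ⟩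
    xs ++ ys ++ zs ++ ws       ↭⟨ ↭.++⁺ˡ xs (↭.shifts ys zs) ⟩
    xs ++ zs ++ ys ++ ws       ≡⟨ List.++-assoc xs zs (ys ++ ws) ⟨
    (xs ++ zs) ++ (ys ++ ws)   ∎

length-take≤ : ∀ {A : Set} k (xs : List A) → length (take k xs) ≤ k
length-take≤ k xs = ℕ.≤-trans (ℕ.≤-reflexive (List.length-take k xs)) (ℕ.m⊓n≤m k (length xs))

length-drop≤ : ∀ {A : Set} k {n} (xs : List A) → length xs ≤ k + n → length (drop k xs) ≤ n
length-drop≤ k {n} xs l = ℕ.≤-trans (ℕ.≤-reflexive (List.length-drop k xs)) (ℕ.m≤n+o⇒m∸n≤o (length xs) k l)

module _ {d} (P Q R : Item d → Set) (k l m : ℕ)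
         (fit : ∀ a b c → All P a → All Q b → All R c →
                length a ≤ k → length b ≤ l → length c ≤ m → Fits (a ++ b ++ c)) where

  -- Each bin takes the next `k`, `l` and `m` items of the three classes, or whatever is left of
  -- them; by the length bounds nothing remains after `n` bins.
  pack : ∀ n {a b c} → All P a → All Q b → All R c →
         length a ≤ n * k → length b ≤ n * l → length c ≤ n * m → Packable n (a ++ b ++ c)
  pack zero {[]} {[]} {[]} _ _ _ _ _ _ = [] , ↭.refl , [] , z≤n
  pack (suc n) {a} {b} {c} pa pb pc la lb lc
    with pack n (All.drop⁺ k pa) (All.drop⁺ l pb) (All.drop⁺ m pc)
              (length-drop≤ k a la) (length-drop≤ l b lb) (length-drop≤ m c lc)
  ... | bs , p , f , len =
    b₀ ∷ bs ,
    ↭.↭-trans (↭.++⁺ˡ b₀ p)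
      (↭.↭-trans (interleave (take k a) (drop k a) (take l b) (drop l b) (take m c) (drop m c))
        (↭.↭-reflexive (cong₂ _++_ (List.take++drop≡id k a)
          (cong₂ _++_ (List.take++drop≡id l b) (List.take++drop≡id m c))))) ,
    fit (take k a) (take l b) (take m c) (All.take⁺ k pa) (All.take⁺ l pb) (All.take⁺ m pc)
        (length-take≤ k a) (length-take≤ l b) (length-take≤ m c) ∷ f ,
    s≤s len
    where
    b₀ : Bin d
    b₀ = take k a ++ take l b ++ take m c

-- Updates of a single bin and gaps of the binary search

module _ {a p} {A : Set a} {P : A → Set p} where

  All-updateAt : ∀ {f : A → A} → (∀ {x} → P x → P (f x)) → ∀ {xs} i → All P xs → All P (xs [ i ]%= f)
  All-updateAt Pf zero    (px ∷ pxs) = Pf px ∷ pxs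
  All-updateAt Pf (suc i) (px ∷ pxs) = px ∷ All-updateAt Pf i pxs

  -- Singles out the updated bin, so that a bound known before the update can be played off against
  -- feasibility after it.
  All-updateAt⁻ : ∀ {q} {Q : A → Set q} {f : A → A} {xs} i → All P xs → All Q (xs [ i ]%= f) → ∃[ x ] (P x × Q (f x))
  All-updateAt⁻ zero    (px ∷ _)   (qx ∷ _)   = _ , px , qx
  All-updateAt⁻ (suc i) (_ ∷ pxs) (_ ∷ qxs) = All-updateAt⁻ i pxs qxs

concat-updateAt : ∀ {A : Set} (x : A) (xss : List (List A)) i → concat (xss [ i ]%= (x ∷_)) ↭ x ∷ concat xss
concat-updateAt x (_ ∷ _)    zero    = ↭.refl
concat-updateAt x (ys ∷ xss) (suc i) =
  ↭.↭-trans (↭.++⁺ˡ ys (concat-updateAt x xss i)) (↭.shift x ys (concat xss))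

-- Binary search: a window lo ≤ hi of ratio gap C (suc r) is split by lo * gap C r
-- into two windows of ratio gap C r.
gap : ℕ → ℕ → ℕ
gap C zero    = C
gap C (suc r) = gap C r * gap C r

gap-nonZero : ∀ C .{{_ : NonZero C}} r → NonZero (gap C r)
gap-nonZero C zero    = ℕ.>-nonZero (ℕ.>-nonZero⁻¹ C)
gap-nonZero C (suc r) = ℕ.m*n≢0 (gap C r) (gap C r) {{gap-nonZero C r}} {{gap-nonZero C r}}

C≤gap : ∀ C .{{_ : NonZero C}} r → C ≤ gap C r
C≤gap C zero    = ℕ.≤-refl
C≤gap C (suc r) = ℕ.≤-trans (C≤gap C r) (ℕ.m≤m*n (gap C r) (gap C r) {{gap-nonZero C r}})

-- Sizes in multiples of `1/D`

module Grid (D : ℕ) .{{_ : NonZero D}} where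

  -- Opaque so that v is inferred from ⟦ v ⟧.
  opaque

    ⟦_⟧ : ∀ {d} → Vec ℕ d → Vec ℚ d
    ⟦_⟧ = Vec.map (λ a → + a / D)

    ⟦⟧-mono : ∀ {d} {u v : Vec ℕ d} → Pointwise _≤_ u v → ⟦ u ⟧ ≼ ⟦ v ⟧
    ⟦⟧-mono []       = []
    ⟦⟧-mono (p ∷ ps) = /-mono-≤ D p ∷ ⟦⟧-mono ps

    ⟦⟧-⊞ : ∀ {d} (u v : Vec ℕ d) → zipWith ℚ._+_ ⟦ u ⟧ ⟦ v ⟧ ≡ ⟦ u ⊞ v ⟧
    ⟦⟧-⊞ []      []      = refl
    ⟦⟧-⊞ (a ∷ u) (b ∷ v) = cong₂ _∷_ (/-homo-+ a b D) (⟦⟧-⊞ u v)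

    ⟦0⟧ : ∀ d → ⟦ replicate d 0 ⟧ ≡ replicate d 0ℚ
    ⟦0⟧ d = trans (Vec.map-replicate _ 0 d) (cong (replicate d) (0/≡0 D))

    ⟦⟧-≢0 : ∀ {d} {v : Vec ℕ d} → v ≢ replicate d 0 → ⟦ v ⟧ ≢ replicate d 0ℚ
    ⟦⟧-≢0 v≢0 eq = v≢0 (⟦⟧-≡0 _ eq)
      where
      ⟦⟧-≡0 : ∀ {d} (v : Vec ℕ d) → ⟦ v ⟧ ≡ replicate d 0ℚ → v ≡ replicate d 0
      ⟦⟧-≡0 []      _  = refl
      ⟦⟧-≡0 (a ∷ v) eq = cong₂ _∷_ (/≡0⇒≡0 a D (Vec.∷-injectiveˡ eq)) (⟦⟧-≡0 v (Vec.∷-injectiveʳ eq))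

    mkItem : ∀ {d} (v : Vec ℕ d) → VecAll.All (_≤ D) v → v ≢ replicate d 0 → Σ[ x ∈ Item d ] Item.coords x ≡ ⟦ v ⟧
    mkItem v v≤D v≢0 = record { coords = ⟦ v ⟧ ; unitCube = cube v≤D ; nonZero = ⟦⟧-≢0 v≢0 } , refl
      where
      cube : ∀ {d} {v : Vec ℕ d} → VecAll.All (_≤ D) v → VecAll.All (λ q → 0ℚ ℚ.≤ q × q ℚ.≤ 1ℚ) ⟦ v ⟧
      cube []                 = []
      cube (_∷_ {x = a} p ps) = (subst (ℚ._≤ + a / D) (0/≡0 D) (/-mono-≤ {0} {a} D z≤n) , ≤⇒/≤1 a D p) ∷ cube ps

    load-[]-≼ : ∀ {d} (v : Vec ℕ d) → load {d} [] ≼ ⟦ v ⟧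
    load-[]-≼ []      = []
    load-[]-≼ (a ∷ v) = subst (ℚ._≤ + a / D) (0/≡0 D) (/-mono-≤ {0} {a} D z≤n) ∷ load-[]-≼ v

    ≼-load : ∀ {d} (b : Bin d) → ⟦ replicate d 0 ⟧ ≼ load b
    ≼-load {d} []      = ≼-reflexive (⟦0⟧ d)
    ≼-load     (x ∷ b) = ≼-trans (≼-load b) (load-∷-≽ x b)

    load-∷-≼ : ∀ {d} {x : Item d} {b u v} → Item.coords x ≼ ⟦ u ⟧ → load b ≼ ⟦ v ⟧ → load (x ∷ b) ≼ ⟦ u ⊞ v ⟧
    load-∷-≼ {u = u} {v} p q = ≼-trans (⊕-mono p q) (≼-reflexive (⟦⟧-⊞ u v))

    ≼-load-∷ : ∀ {d} {x : Item d} {b u v} → ⟦ u ⟧ ≼ Item.coords x → ⟦ v ⟧ ≼ load b → ⟦ u ⊞ v ⟧ ≼ load (x ∷ b)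
    ≼-load-∷ {u = u} {v} p q = ≼-trans (≼-reflexive (sym (⟦⟧-⊞ u v))) (⊕-mono p q)

    ≼-load-[x] : ∀ {d} {x : Item d} {u v} → Item.coords x ≡ ⟦ u ⟧ → Pointwise _≤_ v u → ⟦ v ⟧ ≼ load [ x ]
    ≼-load-[x] {d} {x} {u} eq v≤u = ≼-trans (⟦⟧-mono v≤u)
      (≼-reflexive (trans (sym eq) (sym (Vec.zipWith-identityʳ ℚ.+-identityʳ (Item.coords x)))))

    load-++-≼ : ∀ {d} {xs ys : Bin d} {w v n} → All (λ x → Item.coords x ≼ ⟦ w ⟧) xs → length xs ≤ n →
                load ys ≼ ⟦ v ⟧ → load (xs ++ ys) ≼ ⟦ n ⊡ w ⊞ v ⟧
    -- `n` only bounds the length; the surplus copies of `w` are nonnegative and merely weaken the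
    -- bound.
    load-++-≼ {w = w} {v} {n} [] _ q = ≼-trans q (⟦⟧-mono (v≤u⊞v (n ⊡ w) v))
    load-++-≼ {xs = x ∷ xs} {ys} {w = w} {v} {suc n} (p ∷ ps) (s≤s l) q = subst (λ u → load (x ∷ xs ++ ys) ≼ ⟦ u ⟧)
      (sym (suc⊡⊞ n w v)) (load-∷-≼ {x = x} {xs ++ ys} p (load-++-≼ ps l q))

    ≼-load-++ : ∀ {d} {xs ys : Bin d} {w} → All (λ x → ⟦ w ⟧ ≼ Item.coords x) xs → ⟦ length xs ⊡ w ⟧ ≼ load (xs ++ ys)
    ≼-load-++ {ys = ys} {w} [] = subst (λ u → ⟦ u ⟧ ≼ load ys) (sym (0⊡ w)) (≼-load ys)
    ≼-load-++ {xs = x ∷ xs} {ys} {w} (p ∷ ps) = subst (λ u → ⟦ u ⟧ ≼ load (x ∷ xs ++ ys))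
      (sym (suc⊡ (length xs) w)) (≼-load-∷ {x = x} {xs ++ ys} p (≼-load-++ ps))

    fits : ∀ {d} {b : Bin d} {v} → load b ≼ ⟦ v ⟧ → VecAll.All (_≤ D) v → Fits b
    fits = go
      where
      go : ∀ {d} {q : Vec ℚ d} {v} → q ≼ ⟦ v ⟧ → VecAll.All (_≤ D) v → VecAll.All (ℚ._≤ 1ℚ) q
      go {v = []}    []       []       = []
      go {v = a ∷ _} (p ∷ ps) (l ∷ ls) = ℚ.≤-trans p (≤⇒/≤1 a D l) ∷ go ps ls

    fits⁻ : ∀ {d} {b : Bin d} {v} → Fits b → ⟦ v ⟧ ≼ load b → VecAll.All (_≤ D) v
    fits⁻ = go
      where
      go : ∀ {d} {q : Vec ℚ d} {v} → VecAll.All (ℚ._≤ 1ℚ) q → ⟦ v ⟧ ≼ q → VecAll.All (_≤ D) v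
      go {v = []}    []       []       = []
      go {v = a ∷ _} (l ∷ ls) (p ∷ ps) = /≤1⇒≤ a D (ℚ.≤-trans p l) ∷ go ls ps

    load-concat : ∀ {d} {bs : List (Bin d)} → All Fits bs → load (concat bs) ≼ ⟦ replicate d (length bs * D) ⟧
    load-concat [] = load-[]-≼ _
    load-concat {d} {b ∷ bs} (f ∷ fs) = ≼-trans (load-++ b (concat bs)) (≼-trans
      (⊕-mono (full f) (load-concat fs))
      (≼-reflexive (trans (⟦⟧-⊞ (replicate d D) _) (cong ⟦_⟧ (Vec.zipWith-replicate _+_ D (length bs * D))))))
      where
      load-++ : ∀ (xs ys : Bin d) → load (xs ++ ys) ≼ zipWith ℚ._+_ (load xs) (load ys)
      load-++ []       ys = ≼-reflexive (sym (Vec.zipWith-identityˡ ℚ.+-identityˡ (load ys)))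
      load-++ (x ∷ xs) ys = ≼-trans (⊕-mono (≼-reflexive refl) (load-++ xs ys))
        (≼-reflexive (sym (Vec.zipWith-assoc ℚ.+-assoc (Item.coords x) (load xs) (load ys))))
      full : ∀ {d} {q : Vec ℚ d} → VecAll.All (ℚ._≤ 1ℚ) q → q ≼ ⟦ replicate d D ⟧
      full []       = []
      full (l ∷ ls) = ℚ.≤-trans l (ℚ.≤-reflexive (sym (D/D≡1 D))) ∷ full ls

    -- Volume argument: a packing only rearranges the items, and a feasible bin contributes at most
    -- `D` units to each coordinate.
    volume-bound : ∀ {d} {L : Input d} {bs v} → concat bs ↭ L → All Fits bs → ⟦ v ⟧ ≼ load L →
                   VecAll.All (_≤ length bs * D) v
    volume-bound {d} {bs = bs} {v} p fs q =
      cancel v (≼-trans q (≼-trans (≼-reflexive (sym (load-↭ p))) (load-concat fs)))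
      where
      cancel : ∀ {d} (v : Vec ℕ d) → ⟦ v ⟧ ≼ ⟦ replicate d (length bs * D) ⟧ → VecAll.All (_≤ length bs * D) v
      cancel []      []       = []
      cancel (a ∷ v) (p ∷ ps) = /-cancel-≤ D p ∷ cancel v ps

    load-++₃-≼ : ∀ {d} {a b c : Bin d} {u v w k l m} →
      All (λ x → Item.coords x ≼ ⟦ u ⟧) a → All (λ x → Item.coords x ≼ ⟦ v ⟧) b → All (λ x → Item.coords x ≼ ⟦ w ⟧) c →
      length a ≤ k → length b ≤ l → length c ≤ m →
      load (a ++ b ++ c) ≼ ⟦ k ⊡ u ⊞ (l ⊡ v ⊞ (m ⊡ w ⊞ replicate d 0)) ⟧
    load-++₃-≼ {d} {a} {b} {c} {u} {v} {w} {k} {l} {m} pa pb pc la lb lc =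
      subst (λ c → load (a ++ b ++ c) ≼ ⟦ k ⊡ u ⊞ (l ⊡ v ⊞ (m ⊡ w ⊞ replicate d 0)) ⟧) (List.++-identityʳ c)
        (load-++-≼ pa la (load-++-≼ pb lb (load-++-≼ pc lc (load-[]-≼ (replicate d 0)))))

    -- Reduces feasibility of all bins to one capacity check, for a bin with the full numbers of
    -- items, all of the extremal sizes `u`, `v` and `w`.
    pack-bounded : ∀ {d} {u v w : Vec ℕ d} {k l m} →
      VecAll.All (_≤ D) (k ⊡ u ⊞ (l ⊡ v ⊞ (m ⊡ w ⊞ replicate d 0))) → ∀ n {a b c} →
      All (λ x → Item.coords x ≼ ⟦ u ⟧) a → All (λ x → Item.coords x ≼ ⟦ v ⟧) b → All (λ x → Item.coords x ≼ ⟦ w ⟧) c →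
      length a ≤ n * k → length b ≤ n * l → length c ≤ n * m → Packable n (a ++ b ++ c)
    pack-bounded {u = u} {v} {w} {k} {l} {m} cap = pack
      (λ x → Item.coords x ≼ ⟦ u ⟧) (λ x → Item.coords x ≼ ⟦ v ⟧) (λ x → Item.coords x ≼ ⟦ w ⟧) k l m
      (λ a b c pa pb pc la lb lc → fits {b = a ++ b ++ c} (load-++₃-≼ pa pb pc la lb lc) cap)

-- One phase of the adaptive adversary

module Adversary
  {d} (A : OnlineAlgorithm d) (C : ℕ) .{{_ : NonZero C}} (top : ℕ)
  (Shape : ℕ → Item d → Set) (item : ∀ s → s ≤ top → ∃[ x ] Shape s x)
  -- In Inv hi j bs, no opener so far is smaller than hi, and j is the number of joiners.
  (Inv : ℕ → ℕ → List (Bin d) → Set)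
  (opened : ∀ {hi j bs s x} → s ≤ hi → Shape s x → Inv hi j bs → Inv s j ([ x ] ∷ bs))
  (joined : ∀ {hi j bs s x} i → s ≤ hi → Shape s x → All Fits (bs [ i ]%= (x ∷_)) →
            Inv hi j bs → Inv hi (suc j) (bs [ i ]%= (x ∷_)))
  where

  open OnlineAlgorithm A

  Sized : ℕ → Item d → Set
  Sized u x = ∃[ s ] (s ≤ u × Shape s x)

  Sized-mono : ∀ {u v xs} → u ≤ v → All (Sized u) xs → All (Sized v) xs
  Sized-mono u≤v = All.map λ (s , s≤u , sh) → s , ℕ.≤-trans s≤u u≤v , sh

  -- `r` counts the search steps reserved for later phases. Joiners have size at most `lo′`, while
  -- `Inv` carries the lower bound `hi′` for openers; `window` separates the two.
  record Outcome (L : Input d) (n r lo hi j : ℕ) : Set where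
    field
      L′ openers joiners    : Input d
      lo′ hi′               : ℕ
      extends               : ∃[ P ] (L′ ≡ L ++ P × P ↭ openers ++ joiners)
      count                 : length openers + length joiners ≡ n
      bins                  : cost L′ ≡ length openers + cost L
      lo≤lo′                : lo ≤ lo′
      hi′≤hi                : hi′ ≤ hi
      window                : lo′ * gap C r ≤ hi′
      openers-sized         : All (Sized hi) openers
      joiners-sized         : All (Sized lo′) joiners
      invariant             : Inv hi′ (length joiners + j) (packing L′)

  -- The offered size becomes the new `hi` if it opens a bin and the new `lo` if it joins one. Later
  -- sizes stay between the two, so all openers end up above all joiners.
  play : ∀ n r {lo hi j} L → hi ≤ top → lo * gap C (n + r) ≤ hi → Inv hi j (packing L) →
         Outcome L n r lo hi j
  play zero r L hi≤top w inv = record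
    { L′ = L ; openers = [] ; joiners = []
    ; extends = [] , sym (List.++-identityʳ L) , ↭.refl
    ; count = refl ; bins = refl ; lo≤lo′ = ℕ.≤-refl ; hi′≤hi = ℕ.≤-refl ; window = w
    ; openers-sized = [] ; joiners-sized = [] ; invariant = inv }
  play (suc n) r {lo} {hi} {j} L hi≤top w inv = answer (decide L x) (packing-∷ʳ L x)
    where
    g s : ℕ
    g = gap C (n + r)
    -- The required ratio is `g * g`, so both `[lo, s]` and `[s, hi]` keep ratio `g` for the
    -- remaining steps.
    s = lo * g
    sg≤hi : s * g ≤ hi
    sg≤hi = ℕ.≤-trans (ℕ.≤-reflexive (ℕ.*-assoc lo g g)) w
    instance
      g≢0 : NonZero g
      g≢0 = gap-nonZero C (n + r)
    s≤hi : s ≤ hi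
    s≤hi = ℕ.≤-trans (ℕ.m≤m*n s g) sg≤hi
    s≤top : s ≤ top
    s≤top = ℕ.≤-trans s≤hi hi≤top
    x : Item d
    x = proj₁ (item s s≤top)
    shape : Shape s x
    shape = proj₂ (item s s≤top)

    answer : ∀ δ → packing (L ∷ʳ x) ≡ place (packing L) x δ → Outcome L (suc n) r lo hi j
    answer newBin eq = record
      { L′ = O.L′ ; openers = x ∷ O.openers ; joiners = O.joiners
      ; extends = let P , e , p = O.extends in x ∷ P , trans e (List.∷ʳ-++ L x P) , ↭.prep x p
      ; count = cong suc O.count
      ; bins = trans O.bins (trans (cong (ℕ._+_ (length O.openers)) (cong length eq)) (ℕ.+-suc _ _))
      ; lo≤lo′ = O.lo≤lo′ ; hi′≤hi = ℕ.≤-trans O.hi′≤hi s≤hi ; window = O.window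
      ; openers-sized = (s , s≤hi , shape) ∷ Sized-mono s≤hi O.openers-sized
      ; joiners-sized = O.joiners-sized ; invariant = O.invariant }
      where
      module O = Outcome (play n r {lo} {s} {j} (L ∷ʳ x) s≤top ℕ.≤-refl
                           (subst (Inv s j) (sym eq) (opened s≤hi shape inv)))
    answer (intoBin i) eq = record
      { L′ = O.L′ ; openers = O.openers ; joiners = x ∷ O.joiners
      ; extends = let P , e , p = O.extends in
          x ∷ P , trans e (List.∷ʳ-++ L x P) ,
          ↭.↭-trans (↭.prep x p) (↭.↭-sym (↭.shift x O.openers O.joiners))
      ; count = trans (ℕ.+-suc _ _) (cong suc O.count)
      ; bins = trans O.bins (cong (ℕ._+_ (length O.openers)) (trans (cong length eq) (List.length-%= (packing L) i _)))
      ; lo≤lo′ = ℕ.≤-trans (ℕ.m≤m*n lo g) O.lo≤lo′ ; hi′≤hi = O.hi′≤hi ; window = O.window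
      ; openers-sized = O.openers-sized
      ; joiners-sized = (s , O.lo≤lo′ , shape) ∷ O.joiners-sized
      ; invariant = subst (λ m → Inv O.hi′ m (packing O.L′)) (ℕ.+-suc _ _) O.invariant }
      where
      module O = Outcome (play n r {s} {hi} {suc j} (L ∷ʳ x) hi≤top sg≤hi
                           (subst (Inv hi (suc j)) (sym eq)
                             (joined i s≤hi shape (subst (All Fits) eq (feasible (L ∷ʳ x))) inv)))

-- Conservation of items and counting inequalities

packing-partition : ∀ {d} (A : OnlineAlgorithm d) L → concat (OnlineAlgorithm.packing A L) ↭ L
-- `packing` is specified by appending at the end, so the induction runs over the reversed input.
packing-partition A L = subst (λ L → concat (packing L) ↭ L) (List.reverse-involutive L) (reversed (reverse L))
  where
  open OnlineAlgorithm A
  placed : ∀ bs x (δ : Decision bs) → concat (place bs x δ) ↭ x ∷ concat bs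
  placed bs x newBin      = ↭.refl
  placed bs x (intoBin i) = concat-updateAt x bs i
  reversed : ∀ L → concat (packing (reverse L)) ↭ reverse L
  reversed []      = ↭.↭-reflexive (cong concat packing-[])
  reversed (x ∷ L) rewrite List.unfold-reverse x L | packing-∷ʳ (reverse L) x =
    ↭.↭-trans (placed (packing (reverse L)) x (decide (reverse L) x))
      (↭.↭-trans (↭.prep x (reversed L)) (↭.∷↭∷ʳ x (reverse L)))

-- `q` and `t` count the second items that open and join bins, `z` the third items. Take the
-- equation three times, the bound by bins once and the bound by `z` twice; the summand 2 comes from
-- rounding `t / 2`.
gadget-count : ∀ {b M q t z} → t ≤ q + b → q + t ≡ M * 2 → t ≤ 1 + z * 2 →
               3 * b + 6 * M ≤ 4 * (z + (q + b)) + 2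
gadget-count {b} {M} {q} {t} {z} t≤q+b q+t≡2M t≤1+2z = begin
  3 * b + 6 * M                              ≡⟨ lemma₁ b M ⟩
  3 * b + M * 2 * 3                          ≡⟨ cong (λ m → 3 * b + m * 3) q+t≡2M ⟨
  3 * b + (q + t) * 3                        ≡⟨ lemma₂ b q t ⟩
  3 * b + 3 * q + t * 2 + t                  ≤⟨ ℕ.+-mono-≤ (ℕ.+-monoʳ-≤ (3 * b + 3 * q) (ℕ.*-monoˡ-≤ 2 t≤1+2z)) t≤q+b ⟩
  3 * b + 3 * q + (1 + z * 2) * 2 + (q + b)  ≡⟨ lemma₃ b q z ⟩
  4 * (z + (q + b)) + 2                      ∎
  where
  open ℕ.≤-Reasoning
  lemma₁ : ∀ b M → 3 * b + 6 * M ≡ 3 * b + M * 2 * 3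
  lemma₁ = solve-∀
  lemma₂ : ∀ b q t → 3 * b + (q + t) * 3 ≡ 3 * b + 3 * q + t * 2 + t
  lemma₂ = solve-∀
  lemma₃ : ∀ b q z → 3 * b + 3 * q + (1 + z * 2) * 2 + (q + b) ≡ 4 * (z + (q + b)) + 2
  lemma₃ = solve-∀

-- Here v is the denominator of the alleged ratio 9/4 − ε, and k = 9v = e + 1 ≥ 9/ε.
ratio-arith : ∀ v .{{_ : NonZero v}} {e k M b m n c} → k ≡ suc e → 9 * v ≡ k →
              M ≤ b → m * k ≤ b → n ≤ M + suc m → 3 * b + 6 * M ≤ 4 * c + 2 → 4 * c * v ≤ e * n →
              M ≤ e * k + 2 * v * k
ratio-arith v {e} {k} {M} {b} {m} {n} {c} k≡1+e 9v≡k M≤b mk≤b n≤ count ratio≤ =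
  -- The lower and upper bounds of `(3 * b + 6 * M) * v * k` share these two terms; cancelling them
  -- leaves a bound on `M`.
  ℕ.+-cancelʳ-≤ (e * M * k + e * b) _ _ (begin
    M + (e * M * k + e * b)                        ≤⟨ ℕ.+-cancelʳ-≤ (e * M) _ _ step ⟩
    (3 * b + 6 * M) * v * k                        ≤⟨ ℕ.*-monoˡ-≤ k (ℕ.*-monoˡ-≤ v count) ⟩
    (4 * c + 2) * v * k                            ≡⟨ lemma₁ c v k ⟩
    4 * c * v * k + 2 * v * k                      ≤⟨ ℕ.+-monoˡ-≤ (2 * v * k) (ℕ.*-monoˡ-≤ k ratio≤) ⟩
    e * n * k + 2 * v * k                          ≤⟨ ℕ.+-monoˡ-≤ (2 * v * k) (ℕ.*-monoˡ-≤ k (ℕ.*-monoʳ-≤ e n≤)) ⟩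
    e * (M + suc m) * k + 2 * v * k                ≡⟨ lemma₂ e M m k v ⟩
    e * (m * k) + (e * M * k + e * k + 2 * v * k)  ≤⟨ ℕ.+-monoˡ-≤ _ (ℕ.*-monoʳ-≤ e mk≤b) ⟩
    e * b + (e * M * k + e * k + 2 * v * k)        ≡⟨ lemma₃ e b M k v ⟩
    e * k + 2 * v * k + (e * M * k + e * b)        ∎)
  where
  open ℕ.≤-Reasoning
  lemma₁ : ∀ c v k → (4 * c + 2) * v * k ≡ 4 * c * v * k + 2 * v * k
  lemma₁ = solve-∀
  lemma₂ : ∀ e M m k v → e * (M + suc m) * k + 2 * v * k ≡ e * (m * k) + (e * M * k + e * k + 2 * v * k)
  lemma₂ = solve-∀
  lemma₃ : ∀ e b M k v → e * b + (e * M * k + e * k + 2 * v * k) ≡ e * k + 2 * v * k + (e * M * k + e * b)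
  lemma₃ = solve-∀
  lemma₄ : ∀ e b M k → M + (e * M * k + e * b) + e * M ≡ e * b + suc e * M + e * k * M
  lemma₄ = solve-∀
  lemma₅ : ∀ e b M k → e * b + k * M + e * k * M ≡ e * b + suc e * k * M
  lemma₅ = solve-∀
  lemma₆ : ∀ v k M → 9 * v * k * M ≡ 3 * (3 * v * k) * M
  lemma₆ = solve-∀
  lemma₇ : ∀ e r b M → e * b + 3 * (e + r) * M ≡ r * M + (e * b + (e + r) * (2 * M) + e * M)
  lemma₇ = solve-∀
  lemma₈ : ∀ e r b M → r * b + (e * b + (e + r) * (2 * M) + e * M) ≡ (e + r) * (b + 2 * M) + e * M
  lemma₈ = solve-∀
  lemma₉ : ∀ v k b M → 3 * v * k * (b + 2 * M) ≡ (3 * b + 6 * M) * v * k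
  lemma₉ = solve-∀
  e≤3vk : e ≤ 3 * v * k
  e≤3vk = ℕ.≤-trans (ℕ.n≤1+n e) (ℕ.≤-trans (ℕ.≤-reflexive (sym k≡1+e))
    (ℕ.m≤n*m k (3 * v) {{ℕ.m*n≢0 3 v}}))
  r : ℕ
  r = 3 * v * k ∸ e
  e+r : e + r ≡ 3 * v * k
  e+r = ℕ.m+[n∸m]≡n e≤3vk
  -- Of the coefficient `3 * v * k = e + r` of `b`, the part `e` is kept and `M ≤ b` is applied to
  -- `r`. The rest is `k * k * M` with one `k` expanded as `e + 1`, which yields the isolated `M`.
  step : M + (e * M * k + e * b) + e * M ≤ (3 * b + 6 * M) * v * k + e * M
  step = begin
    M + (e * M * k + e * b) + e * M                  ≡⟨ lemma₄ e b M k ⟩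
    e * b + suc e * M + e * k * M                    ≡⟨ cong (λ i → e * b + i * M + e * k * M) k≡1+e ⟨
    e * b + k * M + e * k * M                        ≡⟨ lemma₅ e b M k ⟩
    e * b + suc e * k * M                            ≡⟨ cong (λ i → e * b + i * k * M) (trans 9v≡k k≡1+e) ⟨
    e * b + 9 * v * k * M                            ≡⟨ cong (λ i → e * b + i) (lemma₆ v k M) ⟩
    e * b + 3 * (3 * v * k) * M                      ≡⟨ cong (λ i → e * b + 3 * i * M) e+r ⟨
    e * b + 3 * (e + r) * M                          ≡⟨ lemma₇ e r b M ⟩
    r * M + (e * b + (e + r) * (2 * M) + e * M)      ≤⟨ ℕ.+-monoˡ-≤ _ (ℕ.*-monoʳ-≤ r M≤b) ⟩
    r * b + (e * b + (e + r) * (2 * M) + e * M)      ≡⟨ lemma₈ e r b M ⟩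
    (e + r) * (b + 2 * M) + e * M                    ≡⟨ cong (λ i → i * (b + 2 * M) + e * M) e+r ⟩
    3 * v * k * (b + 2 * M) + e * M                  ≡⟨ cong (λ i → i + e * M) (lemma₉ v k b M) ⟩
    (3 * b + 6 * M) * v * k + e * M                  ∎

-- The sizes of the construction

module Construction (A : OnlineAlgorithm 3) (k M : ℕ) .{{_ : NonZero k}} where

  open OnlineAlgorithm A

  -- The sizes are given in multiples of 1/D. By the choice of C, hi exceeds both 2k lo and
  -- (2 + k) lo at the end of each phase.
  C top w half E D : ℕ
  C    = 3 + 2 * k
  top  = gap C (M * k + (M * 2 + 0))
  w    = (2 + k) * top
  half = k * w
  E    = w + w
  D    = k * E

  instance
    top≢0 : NonZero top
    top≢0 = gap-nonZero C (M * k + (M * 2 + 0))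
    E≢0 : NonZero E
    E≢0 = ℕ.>-nonZero (ℕ.≤-trans (ℕ.>-nonZero⁻¹ w {{ℕ.m*n≢0 (2 + k) top}}) (ℕ.m≤m+n w w))
    D≢0 : NonZero D
    D≢0 = ℕ.m*n≢0 k E

  D≡half+half : D ≡ half + half
  D≡half+half = ℕ.*-distribˡ-+ k w w

  w≤half : w ≤ half
  w≤half = ℕ.m≤n*m w k

  half≤D : half ≤ D
  half≤D = ℕ.≤-trans (ℕ.m≤m+n half half) (ℕ.≤-reflexive (sym D≡half+half))

  w≤D : w ≤ D
  w≤D = ℕ.≤-trans w≤half half≤D

  top≤D : top ≤ D
  top≤D = ℕ.≤-trans (ℕ.m≤n*m top (2 + k)) w≤D

  E≤D : E ≤ D
  E≤D = ℕ.m≤n*m E k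

  open Grid D

  positive-≢0 : ∀ {a n} {v : Vec ℕ n} → 1 ≤ a → a ∷ v ≢ replicate (suc n) 0
  positive-≢0 (s≤s _) ()

  sized-≼ : ∀ {d} {q : Vec ℚ d} {u v} → q ≡ ⟦ u ⟧ → Pointwise _≤_ u v → q ≼ ⟦ v ⟧
  sized-≼ eq u≤v = ≼-trans (≼-reflexive eq) (⟦⟧-mono u≤v)

  -- Phase one: items filling a `k`-th of the third coordinate

  Shape₁ : ℕ → Item 3 → Set
  Shape₁ s x = Item.coords x ≡ ⟦ s ∷ s ∷ E ∷ [] ⟧

  item₁ : ∀ s → s ≤ top → ∃[ x ] Shape₁ s x
  item₁ s s≤top = mkItem (s ∷ s ∷ E ∷ []) (s≤D ∷ s≤D ∷ E≤D ∷ [])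
    λ eq → ℕ.≢-nonZero⁻¹ E (Vec.∷-injectiveˡ (Vec.∷-injectiveʳ (Vec.∷-injectiveʳ eq)))
    where
    s≤D : s ≤ D
    s≤D = ℕ.≤-trans s≤top top≤D

  -- Every bin keeps its opener. The first coordinate will limit the second items, the second
  -- coordinate will exclude the third items.
  Inv₁ : ℕ → ℕ → List (Bin 3) → Set
  Inv₁ hi _ = All λ b → ⟦ hi ∷ hi ∷ 0 ∷ [] ⟧ ≼ load b

  module Phase₁ = Adversary A C top Shape₁ item₁ Inv₁
    (λ {_} {_} {_} {_} {x} s≤hi shape inv → ≼-load-[x] {x = x} shape (ℕ.≤-refl ∷ ℕ.≤-refl ∷ z≤n ∷ []) ∷
      All.map (≼-trans (⟦⟧-mono (s≤hi ∷ s≤hi ∷ z≤n ∷ []))) inv)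
    (λ {_} {_} {_} {_} {x} i _ _ _ inv → All-updateAt (λ {b} p → ≼-trans p (load-∷-≽ x b)) i inv)

  opaque
    -- `M * 2 + 0` steps stay reserved for phase two. The lower end 1 keeps `lo₁` positive, which
    -- later makes the size gaps strict.
    outcome₁ : Phase₁.Outcome [] (M * k) (M * 2 + 0) 1 top 0
    outcome₁ = Phase₁.play (M * k) (M * 2 + 0) [] ℕ.≤-refl
      (ℕ.≤-reflexive (ℕ.*-identityˡ top)) (subst (Inv₁ top 0) (sym packing-[]) [])

  module O₁ = Phase₁.Outcome outcome₁

  -- Two items of size h fit with k items of size lo₁, but not with one of size hi₁.
  b lo₁ hi₁ h : ℕ
  b   = cost O₁.L′
  lo₁ = O₁.lo′
  hi₁ = O₁.hi′
  h   = half ∸ k * lo₁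

  1+2klo₁≤hi₁ : suc (2 * k * lo₁) ≤ hi₁
  1+2klo₁≤hi₁ = begin
    suc (2 * k * lo₁)             ≤⟨ ℕ.+-monoˡ-≤ (2 * k * lo₁) (ℕ.≤-trans O₁.lo≤lo′ (ℕ.m≤n*m lo₁ 3)) ⟩
    3 * lo₁ + 2 * k * lo₁         ≡⟨ ℕ.*-distribʳ-+ lo₁ 3 (2 * k) ⟨
    C * lo₁                       ≡⟨ ℕ.*-comm C lo₁ ⟩
    lo₁ * C                       ≤⟨ ℕ.*-monoʳ-≤ lo₁ (C≤gap C (M * 2 + 0)) ⟩
    lo₁ * gap C (M * 2 + 0)       ≤⟨ O₁.window ⟩
    hi₁                           ∎
    where open ℕ.≤-Reasoning

  lo₁≤top : lo₁ ≤ top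
  lo₁≤top = ℕ.≤-trans (ℕ.m≤m*n lo₁ _ {{gap-nonZero C (M * 2 + 0)}}) (ℕ.≤-trans O₁.window O₁.hi′≤hi)

  hi₁+klo₁≤half : hi₁ + k * lo₁ ≤ half
  hi₁+klo₁≤half = begin
    hi₁ + k * lo₁             ≤⟨ ℕ.+-mono-≤ O₁.hi′≤hi (ℕ.*-monoʳ-≤ k lo₁≤top) ⟩
    suc k * top               ≤⟨ ℕ.*-monoˡ-≤ top (ℕ.n≤1+n (suc k)) ⟩
    w                         ≤⟨ w≤half ⟩
    half                      ∎
    where open ℕ.≤-Reasoning

  h+klo₁≡half : h + k * lo₁ ≡ half
  h+klo₁≡half = ℕ.m∸n+n≡m (ℕ.≤-trans (ℕ.m≤n+m _ hi₁) hi₁+klo₁≤half)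

  hi₁≤h : hi₁ ≤ h
  hi₁≤h = ℕ.m+n≤o⇒m≤o∸n hi₁ hi₁+klo₁≤half

  -- Two items of size `h` leave room for exactly `2 * k * lo₁`, which is less than `hi₁`.
  2h+hi₁>D : ¬ (h + (h + hi₁) ≤ D)
  2h+hi₁>D le = ℕ.<⇒≱ 1+2klo₁≤hi₁ (ℕ.+-cancelˡ-≤ (h + h) _ _ (begin
    h + h + hi₁                        ≡⟨ ℕ.+-assoc h h hi₁ ⟩
    h + (h + hi₁)                      ≤⟨ le ⟩
    D                                  ≡⟨ D≡half+half ⟩
    half + half                        ≡⟨ cong (λ n → n + n) h+klo₁≡half ⟨
    h + k * lo₁ + (h + k * lo₁)        ≡⟨ lemma h k lo₁ ⟩
    h + h + 2 * k * lo₁                ∎))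
    where
    open ℕ.≤-Reasoning
    lemma : ∀ h k l → h + k * l + (h + k * l) ≡ h + h + 2 * k * l
    lemma = solve-∀

  klo₁+2h≤D : k * lo₁ + (2 * h + 0) ≤ D
  klo₁+2h≤D = begin
    k * lo₁ + (2 * h + 0)              ≤⟨ ℕ.m≤n+m _ (k * lo₁) ⟩
    k * lo₁ + (k * lo₁ + (2 * h + 0))  ≡⟨ lemma (k * lo₁) h ⟩
    h + k * lo₁ + (h + k * lo₁)        ≡⟨ cong (λ n → n + n) h+klo₁≡half ⟩
    half + half                        ≡⟨ D≡half+half ⟨
    D                                  ∎
    where
    open ℕ.≤-Reasoning
    lemma : ∀ m h → m + (m + (2 * h + 0)) ≡ h + m + (h + m)
    lemma = solve-∀

  1≤hi₁ : 1 ≤ hi₁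
  1≤hi₁ = ℕ.≤-trans (s≤s z≤n) 1+2klo₁≤hi₁

  h≤D : h ≤ D
  h≤D = ℕ.≤-trans (ℕ.m∸n≤m half (k * lo₁)) half≤D

  -- Phase two: items slightly below one half in the first coordinate

  Shape₂ : ℕ → Item 3 → Set
  Shape₂ s x = Item.coords x ≡ ⟦ h ∷ s ∷ 0 ∷ [] ⟧

  item₂ : ∀ s → s ≤ top → ∃[ x ] Shape₂ s x
  item₂ s s≤top = mkItem (h ∷ s ∷ 0 ∷ []) (h≤D ∷ ℕ.≤-trans s≤top top≤D ∷ z≤n ∷ [])
    (positive-≢0 (ℕ.≤-trans 1≤hi₁ hi₁≤h))

  -- Counts the joiners, of which no bin can take two.
  data Joined : ℕ → List (Bin 3) → Set where
    []   : Joined 0 []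
    none : ∀ {j β bs} → ⟦ hi₁ ∷ 0 ∷ 0 ∷ [] ⟧ ≼ load β → Joined j bs → Joined j (β ∷ bs)
    one  : ∀ {j β bs} → ⟦ h + hi₁ ∷ 0 ∷ 0 ∷ [] ⟧ ≼ load β → Joined j bs → Joined (suc j) (β ∷ bs)

  Joined⇒≤ : ∀ {j bs} → Joined j bs → j ≤ length bs
  Joined⇒≤ []         = z≤n
  Joined⇒≤ (none _ J) = ℕ.m≤n⇒m≤1+n (Joined⇒≤ J)
  Joined⇒≤ (one _ J)  = s≤s (Joined⇒≤ J)

  -- A bin starts with at least `hi₁` in the first coordinate, whichever phase opened it. One joiner
  -- raises this to `h + hi₁`; a second one would overflow.
  join : ∀ {j bs s x} i → Shape₂ s x → All Fits (bs [ i ]%= (x ∷_)) → Joined j bs → Joined (suc j) (bs [ i ]%= (x ∷_))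
  join {bs = β ∷ _} {x = x} zero shape _ (none p J) =
    one (≼-load-∷ {x = x} {β} {h ∷ 0 ∷ 0 ∷ []} (≼-trans (⟦⟧-mono (ℕ.≤-refl ∷ z≤n ∷ z≤n ∷ [])) (≼-reflexive (sym shape))) p) J
  join {bs = β ∷ _} {s = s} {x} zero shape (f ∷ _) (one p J)
    with fits⁻ {b = x ∷ β} f (≼-load-∷ {x = x} {β} {h ∷ s ∷ 0 ∷ []} (≼-reflexive (sym shape)) p)
  ... | le ∷ _ = contradiction le 2h+hi₁>D
  join (suc i) shape (_ ∷ fs) (none p J) = none p (join i shape fs J)
  join (suc i) shape (_ ∷ fs) (one p J)  = one p (join i shape fs J)

  Inv₂ : ℕ → ℕ → List (Bin 3) → Set
  Inv₂ hi j bs = All (λ β → ⟦ 0 ∷ hi ∷ 0 ∷ [] ⟧ ≼ load β) bs × Joined j bs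

  module Phase₂ = Adversary A C top Shape₂ item₂ Inv₂
    (λ {_} {_} {_} {_} {x} s≤hi shape (all , J) →
      (≼-load-[x] {x = x} shape (z≤n ∷ ℕ.≤-refl ∷ z≤n ∷ []) ∷ All.map (≼-trans (⟦⟧-mono (z≤n ∷ s≤hi ∷ z≤n ∷ []))) all) ,
      none (≼-load-[x] {x = x} shape (hi₁≤h ∷ z≤n ∷ z≤n ∷ [])) J)
    (λ {_} {_} {_} {_} {x} i _ shape fs (all , J) →
      All-updateAt (λ {β} p → ≼-trans p (load-∷-≽ x β)) i all , join i shape fs J)

  untouched : ∀ {bs} → All (λ β → ⟦ hi₁ ∷ hi₁ ∷ 0 ∷ [] ⟧ ≼ load β) bs → Joined 0 bs
  untouched []       = []
  untouched (p ∷ ps) = none (≼-trans (⟦⟧-mono (ℕ.≤-refl ∷ z≤n ∷ z≤n ∷ [])) p) (untouched ps)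

  opaque
    -- The search resumes in the window left by phase one. Hence `hi₂` bounds the openers of both
    -- phases from below in the second coordinate, and `lo₂` bounds their joiners from above.
    outcome₂ : Phase₂.Outcome O₁.L′ (M * 2) 0 lo₁ hi₁ 0
    outcome₂ = Phase₂.play (M * 2) 0 O₁.L′ O₁.hi′≤hi O₁.window
      (All.map (≼-trans (⟦⟧-mono (z≤n ∷ ℕ.≤-refl ∷ z≤n ∷ []))) O₁.invariant , untouched O₁.invariant)

  module O₂ = Phase₂.Outcome outcome₂

  -- One item of size t fits with 2 + k items of size lo₂, but not with one of size hi₂.
  lo₂ hi₂ t z : ℕ
  lo₂ = O₂.lo′
  hi₂ = O₂.hi′
  t   = D ∸ (2 + k) * lo₂
  z   = length O₂.joiners ℕ./ 2

  1+[2+k]lo₂≤hi₂ : suc ((2 + k) * lo₂) ≤ hi₂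
  1+[2+k]lo₂≤hi₂ = begin
    suc ((2 + k) * lo₂)           ≤⟨ ℕ.+-monoˡ-≤ ((2 + k) * lo₂) (ℕ.≤-trans O₁.lo≤lo′ O₂.lo≤lo′) ⟩
    (3 + k) * lo₂                 ≤⟨ ℕ.*-monoˡ-≤ lo₂ (ℕ.+-monoʳ-≤ 3 (ℕ.m≤n*m k 2)) ⟩
    C * lo₂                       ≡⟨ ℕ.*-comm C lo₂ ⟩
    lo₂ * C                       ≤⟨ O₂.window ⟩
    hi₂                           ∎
    where open ℕ.≤-Reasoning

  hi₂≤top : hi₂ ≤ top
  hi₂≤top = ℕ.≤-trans O₂.hi′≤hi O₁.hi′≤hi

  lo₂≤top : lo₂ ≤ top
  lo₂≤top = ℕ.≤-trans (ℕ.≤-trans (ℕ.m≤n*m lo₂ (2 + k)) (ℕ.n≤1+n _)) (ℕ.≤-trans 1+[2+k]lo₂≤hi₂ hi₂≤top)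

  hi₂+[2+k]lo₂≤D : hi₂ + (2 + k) * lo₂ ≤ D
  hi₂+[2+k]lo₂≤D = begin
    hi₂ + (2 + k) * lo₂           ≤⟨ ℕ.+-mono-≤ hi₂≤top (ℕ.*-monoʳ-≤ (2 + k) lo₂≤top) ⟩
    top + w                       ≤⟨ ℕ.+-monoˡ-≤ w (ℕ.m≤n*m top (2 + k)) ⟩
    E                             ≤⟨ E≤D ⟩
    D                             ∎
    where open ℕ.≤-Reasoning

  t+[2+k]lo₂≡D : t + (2 + k) * lo₂ ≡ D
  t+[2+k]lo₂≡D = ℕ.m∸n+n≡m (ℕ.≤-trans (ℕ.m≤n+m _ hi₂) hi₂+[2+k]lo₂≤D)

  hi₂≤t : hi₂ ≤ t
  hi₂≤t = ℕ.m+n≤o⇒m≤o∸n hi₂ hi₂+[2+k]lo₂≤D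

  t+hi₂>D : ¬ (t + hi₂ ≤ D)
  t+hi₂>D le = ℕ.<⇒≱ 1+[2+k]lo₂≤hi₂ (ℕ.+-cancelˡ-≤ t _ _ (ℕ.≤-trans le (ℕ.≤-reflexive (sym t+[2+k]lo₂≡D))))

  -- Phase three: items almost filling the second coordinate

  Shape₃ : ℕ → Item 3 → Set
  Shape₃ _ x = Item.coords x ≡ ⟦ 0 ∷ t ∷ 0 ∷ [] ⟧

  item₃ : ∀ s → s ≤ top → ∃[ x ] Shape₃ s x
  item₃ _ _ = mkItem (0 ∷ t ∷ 0 ∷ []) (z≤n ∷ ℕ.m∸n≤m D ((2 + k) * lo₂) ∷ z≤n ∷ [])
    λ eq → positive-≢0 (ℕ.≤-trans (ℕ.≤-trans (s≤s z≤n) 1+[2+k]lo₂≤hi₂) hi₂≤t) (Vec.∷-injectiveʳ eq)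

  -- All third items have the same size. The condition `j ≡ 0` records that each of them opens a
  -- bin.
  Inv₃ : ℕ → ℕ → List (Bin 3) → Set
  Inv₃ _ j bs = All (λ β → ⟦ 0 ∷ hi₂ ∷ 0 ∷ [] ⟧ ≼ load β) bs × j ≡ 0

  -- Bins from the first two phases contain an opener of size at least `hi₂`, and bins from the
  -- third contain an item of size `t ≥ hi₂`; next to either there is no room for `t`.
  blocked : ∀ {s x bs} i → Shape₃ s x → All Fits (bs [ i ]%= (x ∷_)) →
            ¬ All (λ β → ⟦ 0 ∷ hi₂ ∷ 0 ∷ [] ⟧ ≼ load β) bs
  blocked {x = x} i shape fs all with All-updateAt⁻ i all fs
  ... | β , p , f with fits⁻ {b = x ∷ β} f (≼-load-∷ {x = x} {β} {0 ∷ t ∷ 0 ∷ []} (≼-reflexive (sym shape)) p)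
  ... | _ ∷ le ∷ _ = t+hi₂>D le

  module Phase₃ = Adversary A C top Shape₃ item₃ Inv₃
    (λ {_} {_} {_} {_} {x} _ shape (all , j≡0) → ≼-load-[x] {x = x} shape (z≤n ∷ hi₂≤t ∷ z≤n ∷ []) ∷ all , j≡0)
    (λ {_} {_} {_} {s} i _ shape fs (all , _) → contradiction all (blocked {s} i shape fs))

  opaque
    outcome₃ : Phase₃.Outcome O₂.L′ z 0 0 hi₂ 0
    outcome₃ = Phase₃.play z 0 O₂.L′ hi₂≤top z≤n (proj₁ O₂.invariant , refl)

  module O₃ = Phase₃.Outcome outcome₃

  -- Counting the bins online and offline

  P₁ P₂ S₁ T₁ S₂ T₂ S₃ T₂₊ T₂₋ T₁₊ T₁₋ : Input 3
  P₁ = proj₁ O₁.extends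
  P₂ = proj₁ O₂.extends
  S₁ = O₁.openers
  T₁ = O₁.joiners
  S₂ = O₂.openers
  T₂ = O₂.joiners
  S₃ = O₃.openers
  -- The small items marked `₊` share their bins with third items; those marked `₋` go into the
  -- other bins.
  T₁₊ = take (z * k) T₁
  T₁₋ = drop (z * k) T₁
  T₂₊ = take (z * 2) T₂
  T₂₋ = drop (z * 2) T₂

  L₁↭ : O₁.L′ ↭ S₁ ++ T₁
  L₁↭ = let _ , e , p = O₁.extends in ↭.↭-trans (↭.↭-reflexive e) p

  L₂↭ : O₂.L′ ↭ (S₁ ++ T₁) ++ (S₂ ++ T₂)
  L₂↭ = let _ , e , p = O₂.extends in ↭.↭-trans (↭.↭-reflexive e) (↭.++⁺ L₁↭ p)

  no-joiners : O₃.joiners ≡ []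
  no-joiners = length≡0 O₃.joiners (trans (sym (ℕ.+-identityʳ _)) (proj₂ O₃.invariant))
    where
    length≡0 : ∀ (xs : Input 3) → length xs ≡ 0 → xs ≡ []
    length≡0 [] _ = refl

  L₃↭ : O₃.L′ ↭ ((S₁ ++ T₁) ++ (S₂ ++ T₂)) ++ S₃
  L₃↭ = let _ , e , p = O₃.extends in
    ↭.↭-trans (↭.↭-reflexive e) (↭.++⁺ L₂↭
      (↭.↭-trans p (↭.↭-reflexive (trans (cong (S₃ ++_) no-joiners) (List.++-identityʳ S₃)))))

  -- Volume in the third coordinate, of which `M * k` items fill a `k`-th each. `R` holds the later
  -- items, so this covers both the algorithm after phase one and every packing of the whole input.
  bins≥M : ∀ {bs R} → concat bs ↭ (S₁ ++ T₁) ++ R → All Fits bs → M ≤ length bs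
  bins≥M {bs} {R} p fs with volume-bound p fs (≼-load-++ {xs = S₁ ++ T₁} {R} (All.++⁺ (deep O₁.openers-sized) (deep O₁.joiners-sized)))
    where
    deep : ∀ {xs u} → All (Phase₁.Sized u) xs → All (λ x → ⟦ 0 ∷ 0 ∷ E ∷ [] ⟧ ≼ Item.coords x) xs
    deep = All.map λ (s , _ , shape) → ≼-trans (⟦⟧-mono (z≤n ∷ z≤n ∷ ℕ.≤-refl ∷ [])) (≼-reflexive (sym shape))
  ... | _ ∷ _ ∷ le ∷ [] = ℕ.*-cancelʳ-≤ M (length bs) D (begin
    M * D                        ≡⟨ ℕ.*-assoc M k E ⟨
    M * k * E                    ≡⟨ cong (_* E) (trans (List.length-++ S₁) O₁.count) ⟨
    length (S₁ ++ T₁) * E        ≤⟨ le ⟩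
    length bs * D                ∎)
    where open ℕ.≤-Reasoning

  M≤b : M ≤ b
  M≤b = bins≥M {R = []} (↭.↭-trans (packing-partition A O₁.L′)
    (↭.↭-trans L₁↭ (↭.↭-reflexive (sym (List.++-identityʳ _))))) (feasible O₁.L′)

  |S₁|≡b : length S₁ ≡ b
  |S₁|≡b = sym (trans O₁.bins (trans (cong (λ bs → length S₁ + length bs) packing-[]) (ℕ.+-identityʳ _)))

  z*2≤|T₂| : z * 2 ≤ length T₂
  z*2≤|T₂| = ℕ.m/n*n≤m (length T₂) 2

  |T₂|≤1+z*2 : length T₂ ≤ 1 + z * 2
  |T₂|≤1+z*2 = ℕ.≤-trans (ℕ.≤-reflexive (ℕ.m≡m%n+[m/n]*n (length T₂) 2))
    (ℕ.+-monoˡ-≤ (z * 2) (ℕ.≤-pred (ℕ.m%n<n (length T₂) 2)))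

  -- Distinct joiners of phase two lie in distinct bins.
  |T₂|≤|S₂|+b : length T₂ ≤ length S₂ + b
  |T₂|≤|S₂|+b = ℕ.≤-trans (ℕ.m≤m+n _ 0) (ℕ.≤-trans (Joined⇒≤ (proj₂ O₂.invariant)) (ℕ.≤-reflexive O₂.bins))

  z≤M : z ≤ M
  z≤M = ℕ.*-cancelʳ-≤ z M 2 (ℕ.≤-trans z*2≤|T₂| (ℕ.≤-trans (ℕ.m≤n+m _ (length S₂)) (ℕ.≤-reflexive O₂.count)))

  |S₃|≡z : length S₃ ≡ z
  |S₃|≡z = trans (sym (ℕ.+-identityʳ _)) (trans (cong (λ xs → length S₃ + length xs) (sym no-joiners)) O₃.count)

  cost-bound : 3 * b + 6 * M ≤ 4 * cost O₃.L′ + 2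
  cost-bound = subst (λ c → 3 * b + 6 * M ≤ 4 * c + 2)
    (sym (trans O₃.bins (cong₂ _+_ |S₃|≡z O₂.bins)))
    (gadget-count {b} {M} {length S₂} {length T₂} {z} |T₂|≤|S₂|+b O₂.count |T₂|≤1+z*2)

  kE+0≤D : k * E + 0 ≤ D
  kE+0≤D = ℕ.≤-reflexive (ℕ.+-identityʳ D)

  ktop≤w : k * top ≤ w
  ktop≤w = ℕ.*-monoˡ-≤ top (ℕ.m≤n+m k 2)

  size₁ : ∀ {u xs} → All (Phase₁.Sized u) xs → All (λ x → Item.coords x ≼ ⟦ u ∷ u ∷ E ∷ [] ⟧) xs
  size₁ = All.map λ (_ , s≤u , shape) → sized-≼ shape (s≤u ∷ s≤u ∷ ℕ.≤-refl ∷ [])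

  size₂ : ∀ {u xs} → All (Phase₂.Sized u) xs → All (λ x → Item.coords x ≼ ⟦ h ∷ u ∷ 0 ∷ [] ⟧) xs
  size₂ = All.map λ (_ , s≤u , shape) → sized-≼ shape (ℕ.≤-refl ∷ s≤u ∷ z≤n ∷ [])

  size₃ : ∀ {u xs} → All (Phase₃.Sized u) xs → All (λ x → Item.coords x ≼ ⟦ 0 ∷ t ∷ 0 ∷ [] ⟧) xs
  size₃ = All.map λ (_ , _ , shape) → sized-≼ shape (z≤n ∷ ℕ.≤-refl ∷ z≤n ∷ [])

  -- All small items have second coordinate at most `lo₂`, so `2 + k` of them leave room for `t`.
  with-third : Packable z (T₁₊ ++ T₂₊ ++ S₃)
  with-third = pack-bounded {k = k} {2} {1} (klo₁+2h≤D ∷ second ∷ kE+0≤D ∷ []) z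
    (All.take⁺ (z * k) (size₁ O₁.joiners-sized)) (All.take⁺ (z * 2) (size₂ O₂.joiners-sized)) (size₃ O₃.openers-sized)
    (length-take≤ (z * k) T₁) (length-take≤ (z * 2) T₂)
    (ℕ.≤-reflexive (trans |S₃|≡z (sym (ℕ.*-identityʳ z))))
    where
    open ℕ.≤-Reasoning
    lemma : ∀ k l t → k * l + (2 * l + (1 * t + 0)) ≡ t + (2 + k) * l
    lemma = solve-∀
    second : k * lo₁ + (2 * lo₂ + (1 * t + 0)) ≤ D
    second = begin
      k * lo₁ + (2 * lo₂ + (1 * t + 0))   ≤⟨ ℕ.+-monoˡ-≤ _ (ℕ.*-monoʳ-≤ k O₂.lo≤lo′) ⟩
      k * lo₂ + (2 * lo₂ + (1 * t + 0))   ≡⟨ lemma k lo₂ t ⟩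
      t + (2 + k) * lo₂                   ≡⟨ t+[2+k]lo₂≡D ⟩
      D                                   ∎

  -- Without a third item, second coordinates up to `top` are harmless, so large second items fit as
  -- well. The second items left over number exactly `2 * (M - z)`.
  without-third : Packable (M ∸ z) (T₁₋ ++ (S₂ ++ T₂₋) ++ [])
  without-third = pack-bounded {v = h ∷ top ∷ 0 ∷ []} {w = replicate 3 0} {k} {2} {0}
    (klo₁+2h≤D ∷ second ∷ kE+0≤D ∷ []) (M ∸ z)
    (All.drop⁺ (z * k) (size₁ O₁.joiners-sized))
    (All.++⁺ (size₂ (Phase₂.Sized-mono O₁.hi′≤hi O₂.openers-sized))
             (All.drop⁺ (z * 2) (size₂ (Phase₂.Sized-mono lo₂≤top O₂.joiners-sized))))
    [] |T₁₋|≤ |S₂++T₂₋|≤ z≤n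
    where
    open ℕ.≤-Reasoning
    second : k * lo₁ + (2 * top + 0) ≤ D
    second = begin
      k * lo₁ + (2 * top + 0)     ≤⟨ ℕ.+-monoˡ-≤ (2 * top + 0) (ℕ.*-monoʳ-≤ k lo₁≤top) ⟩
      k * top + (2 * top + 0)     ≡⟨ lemma k top ⟩
      w                           ≤⟨ w≤D ⟩
      D                           ∎
      where
      lemma : ∀ k n → k * n + (2 * n + 0) ≡ (2 + k) * n
      lemma = solve-∀
    |T₁₋|≤ : length T₁₋ ≤ (M ∸ z) * k
    |T₁₋|≤ = begin
      length T₁₋                  ≡⟨ List.length-drop (z * k) T₁ ⟩
      length T₁ ∸ z * k           ≤⟨ ℕ.∸-monoˡ-≤ (z * k) (ℕ.≤-trans (ℕ.m≤n+m _ (length S₁)) (ℕ.≤-reflexive O₁.count)) ⟩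
      M * k ∸ z * k               ≡⟨ ℕ.*-distribʳ-∸ k M z ⟨
      (M ∸ z) * k                 ∎
    |S₂++T₂₋|≤ : length (S₂ ++ T₂₋) ≤ (M ∸ z) * 2
    |S₂++T₂₋|≤ = begin
      length (S₂ ++ T₂₋)                    ≡⟨ List.length-++ S₂ ⟩
      length S₂ + length T₂₋                ≡⟨ cong (length S₂ ℕ.+_) (List.length-drop (z * 2) T₂) ⟩
      length S₂ + (length T₂ ∸ z * 2)       ≡⟨ ℕ.+-∸-assoc (length S₂) z*2≤|T₂| ⟨
      length S₂ + length T₂ ∸ z * 2         ≡⟨ cong (_∸ z * 2) O₂.count ⟩
      M * 2 ∸ z * 2                         ≡⟨ ℕ.*-distribʳ-∸ 2 M z ⟨
      (M ∸ z) * 2                           ∎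

  -- Even at size `top` the first two coordinates leave room for `k` items, the number that fills
  -- the third. The `suc` rounds `b / k` up.
  large-first : Packable (suc (b ℕ./ k)) (S₁ ++ [] ++ [])
  large-first = pack-bounded {v = replicate 3 0} {w = replicate 3 0} {k} {0} {0}
    (ktop+0≤D ∷ ktop+0≤D ∷ kE+0≤D ∷ []) (suc (b ℕ./ k))
    (size₁ O₁.openers-sized) [] [] |S₁|≤ z≤n z≤n
    where
    ktop+0≤D : k * top + 0 ≤ D
    ktop+0≤D = ℕ.≤-trans (ℕ.≤-reflexive (ℕ.+-identityʳ _)) (ℕ.≤-trans ktop≤w w≤D)
    |S₁|≤ : length S₁ ≤ suc (b ℕ./ k) * k
    |S₁|≤ = ℕ.≤-trans (ℕ.≤-reflexive (trans |S₁|≡b (ℕ.m≡m%n+[m/n]*n b k)))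
      (ℕ.+-monoˡ-≤ _ (ℕ.<⇒≤ (ℕ.m%n<n b k)))

  packable : Packable (M + suc (b ℕ./ k)) O₃.L′
  packable = subst (λ m → Packable (m + suc (b ℕ./ k)) O₃.L′) (ℕ.m+[n∸m]≡n z≤M)
    (Packable-resp-↭ regroup (Packable-++ (Packable-++ with-third without-third) large-first))
    where
    rearrange : ∀ (a b c d e f g : Input 3) →
      ((a ++ c ++ e) ++ (b ++ (f ++ d) ++ [])) ++ (g ++ [] ++ []) ↭ ((g ++ (a ++ b)) ++ (f ++ (c ++ d))) ++ e
    rearrange = solve 7 (λ a b c d e f g →
      ((a ⊕ c ⊕ e) ⊕ (b ⊕ (f ⊕ d) ⊕ id)) ⊕ (g ⊕ id ⊕ id) ⊜ ((g ⊕ (a ⊕ b)) ⊕ (f ⊕ (c ⊕ d))) ⊕ e) ↭.refl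
      where open import Algebra.Solver.CommutativeMonoid (↭.++-commutativeMonoid {A = Item 3})
    regroup : ((T₁₊ ++ T₂₊ ++ S₃) ++ (T₁₋ ++ (S₂ ++ T₂₋) ++ [])) ++ (S₁ ++ [] ++ []) ↭ O₃.L′
    regroup = ↭.↭-trans (rearrange T₁₊ T₁₋ T₂₊ T₂₋ S₃ S₂ S₁) (↭.↭-sym
      (subst₂ (λ xs ys → O₃.L′ ↭ ((S₁ ++ xs) ++ (S₂ ++ ys)) ++ S₃)
        (sym (List.take++drop≡id (z * k) T₁)) (sym (List.take++drop≡id (z * 2) T₂)) L₃↭))

  OPT≥M : ∀ {bs} → IsPacking O₃.L′ bs → M ≤ length bs
  OPT≥M p = bins≥M {R = (S₂ ++ T₂) ++ S₃}
    (↭.↭-trans (IsPacking.partition p) (↭.↭-trans L₃↭ (↭.↭-reflexive (List.++-assoc (S₁ ++ T₁) (S₂ ++ T₂) S₃))))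
    (IsPacking.feasible p)

-- Opaque because the sizes in the construction, doubly exponential in M * k, must not be evaluated.
opaque
  hard-input : ∀ (A : OnlineAlgorithm 3) k M .{{_ : NonZero k}} → ∃[ L ] ∃[ b ]
    (M ≤ b × 3 * b + 6 * M ≤ 4 * OnlineAlgorithm.cost A L + 2 ×
     Packable (M + suc (b ℕ./ k)) L × (∀ {bs} → IsPacking L bs → M ≤ length bs))
  hard-input A k M = O₃.L′ , b , M≤b , cost-bound , packable , OPT≥M
    where open Construction A k M

-- Refuting every ratio below 9/4

¬ratio≤ : ∀ (A : OnlineAlgorithm 3) K q → q ℚ.< + 9 / 4 → ¬ (∀ p → Ratio A K p → p ℚ.≤ q)
¬ratio≤ A K q@(ℚ.mkℚ u v-1 _) q<9/4 ub =
  let L , b , M≤b , cost-bound , packable , OPT≥M = hard-input A k M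
      bs , p , |bs|≤ = Packable⇒IsPacking packable
  -- The goal is the empty type, so an optimum may be assumed despite the double negation.
  in ¬¬IsOPT (suc (length bs)) bs p ℕ.≤-refl λ (n , o , n≤|bs|) →
    let _ , p′ , |bs′|≡n = IsOPT.attained o
        M≤n = ℕ.≤-trans (OPT≥M p′) (ℕ.≤-reflexive |bs′|≡n)
        K≤n = ℕ.≤-trans (ℕ.≤-trans (ℕ.m≤m+n K _) (ℕ.n≤1+n _)) M≤n
        instance n≢0 = ℕ.>-nonZero (ℕ.≤-trans (s≤s z≤n) M≤n)
    in ℕ.<⇒≱ (s≤s (ℕ.m≤n+m _ K))
         (ratio-arith v {e} {c = OnlineAlgorithm.cost A L} refl refl M≤b (ℕ.m/n*n≤m b k) (ℕ.≤-trans n≤|bs| |bs|≤) cost-bound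
           (4cv≤en (OnlineAlgorithm.cost A L) n (ub _ (ratio L n o K≤n))))
  where
  v k e M : ℕ
  v = suc v-1
  k = 9 * v
  e = ℕ.pred k
  -- Exceeds both `K`, so that the optimum is large enough, and the bound on `M` from `ratio-arith`,
  -- which gives the contradiction.
  M = suc (K + (e * k + 2 * v * k))

  -- The strict inequality `4 * u < 9 * v` between integers leaves a margin of one, which is the
  -- source of `e = k - 1`.
  4u≤e : u ℤ.* + 4 ℤ.≤ + e
  4u≤e = ℤ.i<j⇒i≤pred[j] (ℚ.drop-*<* q<9/4)

  4cv≤en : ∀ c n .{{_ : NonZero n}} → + c / n ℚ.≤ q → 4 * c * v ≤ e * n
  4cv≤en c n le = ℤ.drop‿+≤+ (begin
    + (4 * c * v)              ≡⟨ cong (λ m → + m) (lemma c v) ⟩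
    + (c * v * 4)              ≡⟨ ℤ.pos-* (c * v) 4 ⟩
    + (c * v) ℤ.* + 4          ≡⟨ cong (ℤ._* + 4) (ℤ.pos-* c v) ⟩
    + c ℤ.* + v ℤ.* + 4        ≤⟨ ℤ.*-monoʳ-≤-nonNeg (+ 4) (/≤⇒*≤* c n le) ⟩
    u ℤ.* + n ℤ.* + 4          ≡⟨ ℤ.*-assoc u (+ n) (+ 4) ⟩
    u ℤ.* (+ n ℤ.* + 4)        ≡⟨ cong (u ℤ.*_) (ℤ.*-comm (+ n) (+ 4)) ⟩
    u ℤ.* (+ 4 ℤ.* + n)        ≡⟨ ℤ.*-assoc u (+ 4) (+ n) ⟨
    u ℤ.* + 4 ℤ.* + n          ≤⟨ ℤ.*-monoʳ-≤-nonNeg (+ n) 4u≤e ⟩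
    + e ℤ.* + n                ≡⟨ ℤ.pos-* e n ⟨
    + (e * n)                  ∎)
    where
    open ℤ.≤-Reasoning
    lemma : ∀ c v → 4 * c * v ≡ c * v * 4
    lemma = solve-∀

theorem11 : ¬ (Σ[ A ∈ OnlineAlgorithm 3 ] asymptoticRatio A <ᵘ (+ 9 / 4))
theorem11 (A , r , r<9/4 , N , below) =
  -- Only the supremum at the threshold `N` itself is used: it supplies an upper bound `q` of all
  -- its ratios, with `q < r < 9/4`.
  let q , q<r , ub = below N ℕ.≤-refl in ¬ratio≤ A N q (ℚ.<-trans q<r r<9/4) ub
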